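{- Let $S\neq\mathbb Z_{\ge 0}$ be a numerical semigroup, let $m\in S$ be nonzero, and let $c_1<\dots<c_n$ be the elements of $\mathbb Z_{\ge 0}\setminus S$. Let $f$ be an arbitrary function on $\mathbb Z_{\ge 0}$ with values in a commutative ring with unity, and let $p$ be an integer with $0<p\le m$. Then for every $k=1,\dots,p$ $$\sum_{i=1}^n\bigl(f(c_i+m)-f(c_i)\bigr)\Bigl(\sum_{J\subset T_i,\ |J|=p-1}e_{k-1}(f\{J\})\Bigr)=\sum_{I\subset S^{(m)},\ |I|=p}e_k(f\{I\})-\sum_{I\subset I_m,\ |I|=p}e_k(f\{I\}).$$ In particular, for $p=m$, $$\sum_{i=1}^n\bigl(f(c_i+m)-f(c_i)\bigr)e_{k-1}(f\{T_i\})=e_k(f\{S^{(m)}\})-e_k(f\{I_m\}),$$ and for $p=m$, $k=1$ this reads $$\sum_{c\in\mathbb Z_{\ge 0}\setminus S}\bigl(f(c+m)-f(c)\bigr)=\sum_{a\in S^{(m)}}f(a)-\sum_{i=0}^{m-1}f(i).$$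
   Context: A numerical semigroup is a set $S\subset\mathbb Z_{\ge 0}$ that contains $0$, is closed under addition and has finite complement in $\mathbb Z_{\ge 0}$. For a numerical semigroup $S$ and a nonzero $m\in S$, the Apéry set is $S^{(m)}:=\{s\in S: s-m\notin S\}$; it has exactly $m$ elements, one in each residue class mod $m$, and contains $0$. Put $I_m:=\{0,1,\dots,m-1\}$. With $\mathbb Z_{\ge 0}\setminus S=\{c_1<\dots<c_n\}$, let $S_0:=\mathbb Z_{\ge 0}$ and $S_i:=\mathbb Z_{\ge 0}\setminus\{c_1,\dots,c_i\}$ for $i=1,\dots,n$ (so $S_n=S$); each $S_i$ is a numerical semigroup containing $m$. For $i=1,\dots,n$ put $T_i:=S_i^{(m)}\setminus\{c_i+m\}=S_{i-1}^{(m)}\setminus\{c_i\}$, a set of $m-1$ elements. For a finite set $A\subset\mathbb Z_{\ge 0}$, $f\{A\}$ denotes the family $(f(a))_{a\in A}$ of $|A|$ values counted with multiplicity, in any order. The elementary symmetric functions are $e_k(x_1,\dots,x_r):=\sum_{i_1<\dots<i_k}x_{i_1}\cdots x_{i_k}$, with $e_0=1$ (also for $r=0$). -}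

module Defs where

open import Algebra.Bundles using (CommutativeRing)
open import Data.Fin as Fin using (Fin; toℕ)
import Data.Fin.Properties as Fin
open import Data.List using (List; []; _∷_; _++_; map; filter; foldr; upTo; tabulate; deduplicate)
import Data.List.Membership.Propositional as List
open import Data.List.Membership.Propositional.Properties
  using (∈-++⁺ˡ; ∈-++⁺ʳ; ∈-map⁺; ∈-upTo⁺; ∈-tabulate⁺; ∈-filter⁺; ∈-filter⁻; ∈-deduplicate⁺; ∈-deduplicate⁻)
open import Data.List.Relation.Unary.Unique.Propositional using (Unique)
open import Data.List.Relation.Unary.Unique.DecPropositional.Properties using (deduplicate-!)
open import Data.Nat as ℕ using (ℕ; zero; suc; _∸_; _≤_; _<_; _≤?_; _<?_; _≟_)
open import Data.Nat.Properties
open import Data.Product using (∃; _×_; _,_; proj₁; proj₂)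
open import Function.Bundles using (_⇔_; mk⇔; module Equivalence)
open import Level using (0ℓ)
open import Relation.Binary using (_Preserves_⟶_)
open import Relation.Binary.PropositionalEquality
open import Relation.Nullary using (¬_; yes; no; ¬?; _×-dec_; _→-dec_; contradiction)
open import Relation.Unary using (Pred; Decidable; _∈_; _∉_)

-- A finite set of naturals: a decidable predicate whose members all occur in
-- some list.  The list may contain repetitions and non-members; `elements`
-- lists each member exactly once (see ∈-elements and elements-!).
record FiniteSet : Set₁ where
  field
    carrier : Pred ℕ 0ℓ
    _∈?     : Decidable carrier
    finite  : ∃ λ (xs : List ℕ) → ∀ x → x ∈ carrier → x List.∈ xs

  elements : List ℕ
  elements = deduplicate _≟_ (filter _∈? (proj₁ finite))

  ∈-elements : ∀ {x} → x List.∈ elements ⇔ x ∈ carrier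
  ∈-elements = mk⇔
    (λ x∈ → proj₂ (∈-filter⁻ _∈? {xs = proj₁ finite} (∈-deduplicate⁻ _≟_ _ x∈)))
    (λ x∈ → ∈-deduplicate⁺ _≟_ (∈-filter⁺ _∈? (proj₂ finite _ x∈) x∈))

  elements-! : Unique elements
  elements-! = deduplicate-! _≟_ _

open FiniteSet public using (elements)

-- Membership is required to be decidable; classically this is no restriction.
record NumericalSemigroup : Set₁ where
  field
    carrier  : Pred ℕ 0ℓ
    _∈?      : Decidable carrier
    0∈       : 0 ∈ carrier
    +-closed : ∀ {x y} → x ∈ carrier → y ∈ carrier → (x ℕ.+ y) ∈ carrier
    cofinite : ∃ λ (xs : List ℕ) → ∀ x → x ∉ carrier → x List.∈ xs

infix 4 _∈ₛ_ _∉ₛ_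

_∈ₛ_ _∉ₛ_ : ℕ → NumericalSemigroup → Set
x ∈ₛ S = x ∈ NumericalSemigroup.carrier S
x ∉ₛ S = ¬ (x ∈ₛ S)

gaps : NumericalSemigroup → FiniteSet
gaps S = record
  { carrier = _∉ₛ S
  ; _∈?     = λ x → ¬? (NumericalSemigroup._∈? S x)
  ; finite  = NumericalSemigroup.cofinite S
  }

-- In "s - m ∉ S" the difference is an integer, so the condition holds
-- automatically when s < m.
Apéry : NumericalSemigroup → ℕ → FiniteSet
Apéry S m = record
  { carrier = λ s → s ∈ₛ S × ¬ (m ≤ s × (s ∸ m) ∈ₛ S)
  ; _∈?     = λ s → (s ∈S?) ×-dec ¬? ((m ≤? s) ×-dec ((s ∸ m) ∈S?))
  ; finite  = upTo m ++ map (ℕ._+ m) (proj₁ cofinite) , covered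
  }
  where
  open NumericalSemigroup S using (cofinite) renaming (_∈? to _∈S?)
  covered : ∀ s → s ∈ₛ S × ¬ (m ≤ s × (s ∸ m) ∈ₛ S) →
            s List.∈ upTo m ++ map (ℕ._+ m) (proj₁ cofinite)
  covered s (_ , s-m∉) with m ≤? s
  ... | no  m≰s = ∈-++⁺ˡ (∈-upTo⁺ (≰⇒> m≰s))
  ... | yes m≤s = ∈-++⁺ʳ (upTo m) (subst (List._∈ _) (m∸n+n≡m m≤s)
                    (∈-map⁺ (ℕ._+ m) (proj₂ cofinite (s ∸ m) λ s-m∈ → s-m∉ (m≤s , s-m∈))))

I : ℕ → FiniteSet
I m = record
  { carrier = _< m
  ; _∈?     = _<? m
  ; finite  = upTo m , λ _ → ∈-upTo⁺
  }

infixl 6 _∖｛_｝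

_∖｛_｝ : FiniteSet → ℕ → FiniteSet
A ∖｛ a ｝ = record
  { carrier = λ x → x ∈ FiniteSet.carrier A × x ≢ a
  ; _∈?     = λ x → FiniteSet._∈? A x ×-dec ¬? (x ≟ a)
  ; finite  = proj₁ (FiniteSet.finite A) , λ x x∈ → proj₂ (FiniteSet.finite A) x (proj₁ x∈)
  }

-- c 0 < … < c (n - 1) are the elements of ℕ ∖ S.  Indices start at 0, so
-- c i stands for c_{i+1} in the usual 1-based numbering.
record IsGapEnumeration (S : NumericalSemigroup) {n : ℕ} (c : Fin n → ℕ) : Set where
  field
    increasing : c Preserves Fin._<_ ⟶ ℕ._<_
    enumerates : ∀ x → x ∉ₛ S ⇔ ∃ λ i → c i ≡ x

module _ (S : NumericalSemigroup) {n : ℕ} {c : Fin n → ℕ} (gap : IsGapEnumeration S c) where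

  private
    open IsGapEnumeration gap
    module S = NumericalSemigroup S

    _∈ₜ_ : ℕ → ℕ → Set
    x ∈ₜ i = ∀ j → toℕ j < i → x ≢ c j

    c∉S : ∀ j → c j ∉ₛ S
    c∉S j = Equivalence.from (enumerates (c j)) (j , refl)

    reflects : ∀ {k j} → c k ≤ c j → toℕ k ≤ toℕ j
    reflects {k} {j} ck≤cj with toℕ k ≤? toℕ j
    ... | yes k≤j = k≤j
    ... | no  k≰j = contradiction ck≤cj (<⇒≱ (increasing (≰⇒> k≰j)))

    -- an element of S_i below c_j with j < i already lies in S
    below : ∀ {i x j} → toℕ j < i → x ∈ₜ i → x ≤ c j → x ∈ₛ S
    below {i} {x} {j} j<i x∈ x≤cj with S._∈? x
    ... | yes x∈S = x∈S
    ... | no  x∉S with Equivalence.to (enumerates x) x∉S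
    ...   | k , refl = contradiction refl (x∈ k (≤-<-trans (reflects x≤cj) j<i))

  -- S_i = ℕ ∖ {c_1, …, c_i}, i.e. ℕ without the first i gaps.
  truncate : ℕ → NumericalSemigroup
  truncate i = record
    { carrier  = _∈ₜ i
    ; _∈?      = λ x → Fin.all? λ j → (toℕ j <? i) →-dec ¬? (x ≟ c j)
    ; 0∈       = λ j _ 0≡cj → c∉S j (subst (_∈ₛ S) 0≡cj S.0∈)
    ; +-closed = λ {x} {y} x∈ y∈ j j<i x+y≡cj → c∉S j (subst (_∈ₛ S) x+y≡cj
                   (S.+-closed (below j<i x∈ (subst (x ≤_) x+y≡cj (m≤m+n x y)))
                               (below j<i y∈ (subst (y ≤_) x+y≡cj (m≤n+m y x)))))
    ; cofinite = tabulate c , covered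
    }
    where
    covered : ∀ x → ¬ (x ∈ₜ i) → x List.∈ tabulate c
    covered x x∉ with Fin.any? (λ j → x ≟ c j)
    ... | yes (j , refl) = ∈-tabulate⁺ j
    ... | no  ∄j         = contradiction (λ j _ x≡cj → ∄j (j , x≡cj)) x∉

  -- The index i : Fin n stands for i + 1 in the 1-based numbering, so this is
  -- S_{i+1}^{(m)} ∖ {c_{i+1} + m}.
  T : ℕ → Fin n → FiniteSet
  T m i = Apéry (truncate (suc (toℕ i))) m ∖｛ c i ℕ.+ m ｝

-- All ways to choose k positions of a list, each given by the entries there.
choose : ∀ {a} {A : Set a} → ℕ → List A → List (List A)
choose zero    _        = [] ∷ []
choose (suc k) []       = []
choose (suc k) (x ∷ xs) = map (x ∷_) (choose k xs) ++ choose (suc k) xs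

-- The subsets of A of cardinality p, each as a duplicate-free list.
subsets : ℕ → FiniteSet → List (List ℕ)
subsets p A = choose p (elements A)

module SymmetricFunctions {a ℓ} (R : CommutativeRing a ℓ) where
  open CommutativeRing R
  open import Algebra.Properties.CommutativeMonoid.Sum +-commutativeMonoid public
    using (sum-syntax)

  -- ∑[ x ∈ xs ] g x runs over the entries of xs with multiplicity.
  sumOver : ∀ {b} {B : Set b} → List B → (B → Carrier) → Carrier
  sumOver xs g = foldr _+_ 0# (map g xs)

  infixl 10 sumOver
  syntax sumOver xs (λ x → t) = ∑[ x ∈ xs ] t

  e : ℕ → List Carrier → Carrier
  e k xs = ∑[ ys ∈ choose k xs ] foldr _*_ 1# ys

{-# OPTIONS --safe #-}
-- Going from S_{i-1} to S_i replaces c_i by c_i + m in the Apéry set and keeps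
-- the set T_i of the remaining elements.  If F is a symmetric function of a
-- finite set that is affine in the value f(x) of each element, that is
-- F({x} ∪ A) = f(x) G(A) + H(A), then the replacement changes F by
-- (f(c_i + m) - f(c_i)) G(T_i), and these changes telescope from
-- S_0^{(m)} = I_m to S_n^{(m)} = S^{(m)}.
module Submission where

open import Defs
open import Algebra.Bundles using (CommutativeRing)
open import Data.Fin as Fin using (Fin; toℕ)
open import Data.Fin.Properties using (toℕ<n; toℕ-injective) renaming (<-cmp to <ᶠ-cmp)
open import Data.List using (List; []; _∷_; _++_; map; foldr; tabulate)
open import Data.List.Membership.Propositional using () renaming (_∈_ to _∈ˡ_)
open import Data.List.Membership.Propositional.Properties using (∈-tabulate⁺; ∈-tabulate⁻)
open import Data.List.Membership.Propositional.Properties.WithK using (unique∧set⇒bag)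
open import Data.List.Relation.Binary.BagAndSetEquality using (∼bag⇒↭)
open import Data.List.Relation.Binary.Permutation.Propositional
  using (_↭_; refl; prep; swap; trans; ↭-trans; ↭⇒↭ₛ′)
open import Data.List.Relation.Binary.Permutation.Propositional.Properties using (map⁺)
import Data.List.Relation.Binary.Permutation.Setoid.Properties as SetoidPermutation
import Data.List.Relation.Unary.All as All
open import Data.List.Relation.Unary.AllPairs using (_∷_)
open import Data.List.Relation.Unary.Any using (here; there)
open import Data.List.Relation.Unary.Unique.Propositional using (Unique)
open import Data.List.Relation.Unary.Unique.Propositional.Properties using (tabulate⁺)
open import Data.Nat as ℕ using (ℕ; zero; suc; s≤s; _∸_; _≤_; _<_; _≟_)
open import Data.Nat.Properties
  using (<⇒≢; <⇒≱; ≰⇒>; <-asym; <-trans; <-≤-trans; ≤∧≢⇒<; ≤-refl; n≤1+n; m<m+n; n≢0⇒n>0;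
         m≤n+m; m∸n+n≡m; m+n∸n≡m; ∸-monoʳ-<)
open import Data.Product using (_×_; _,_; proj₁; proj₂)
open import Function using (_∘_; _$_)
open import Function.Bundles using (_⇔_; mk⇔; module Equivalence)
open import Function.Construct.Composition using (_⇔-∘_)
open import Function.Construct.Symmetry using (⇔-sym)
open import Relation.Binary using (_Preserves_⟶_; tri<; tri≈; tri>)
open import Relation.Binary.PropositionalEquality as ≡ using (_≡_; _≢_)
import Relation.Binary.Reasoning.Setoid as ≈-Reasoning
open import Relation.Nullary using (¬_; yes; no; contradiction)
open import Relation.Nullary.Decidable using (decidable-stable)

-- Finite sets as lists up to permutation.

unique∧⇔⇒↭ : ∀ {xs ys : List ℕ} → Unique xs → Unique ys →
             (∀ {x} → x ∈ˡ xs ⇔ x ∈ˡ ys) → xs ↭ ys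
unique∧⇔⇒↭ xs! ys! xs⇔ys = ∼bag⇒↭ (unique∧set⇒bag xs! ys! xs⇔ys)

module _ (A : FiniteSet) where
  private module A = FiniteSet A

  -- The order of `elements` depends on the covering list in `finite`, so finite sets with the same
  -- members have lists that agree only up to permutation.
  elements-cong : (B : FiniteSet) → (∀ {x} → A.carrier x ⇔ FiniteSet.carrier B x) →
                  elements A ↭ elements B
  elements-cong B A⇔B = unique∧⇔⇒↭ A.elements-! (FiniteSet.elements-! B)
    (⇔-sym (FiniteSet.∈-elements B) ⇔-∘ (A⇔B ⇔-∘ A.∈-elements))

  -- Brings a chosen member to the head of the list, where the recursions for symmetric functions
  -- act on it.
  elements-∖ : ∀ {a} → A.carrier a → elements A ↭ a ∷ elements (A ∖｛ a ｝)
  elements-∖ {a} a∈A = unique∧⇔⇒↭ A.elements-! (All.tabulate a≢ ∷ A∖a.elements-!)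
    (mk⇔ (split ∘ Equivalence.to A.∈-elements) (Equivalence.from A.∈-elements ∘ merge))
    where
    module A∖a = FiniteSet (A ∖｛ a ｝)

    a≢ : ∀ {x} → x ∈ˡ elements (A ∖｛ a ｝) → a ≢ x
    a≢ x∈ a≡x = proj₂ (Equivalence.to A∖a.∈-elements x∈) (≡.sym a≡x)

    split : ∀ {x} → A.carrier x → x ∈ˡ a ∷ elements (A ∖｛ a ｝)
    split {x} x∈A with x ≟ a
    ... | yes x≡a = here x≡a
    ... | no  x≢a = there (Equivalence.from A∖a.∈-elements (x∈A , x≢a))

    merge : ∀ {x} → x ∈ˡ a ∷ elements (A ∖｛ a ｝) → A.carrier x
    merge (here ≡.refl) = a∈A
    merge (there x∈)    = proj₁ (Equivalence.to A∖a.∈-elements x∈)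

-- Gaps and truncations.

module _ (S : NumericalSemigroup) {n : ℕ} {c : Fin n → ℕ} (gap : IsGapEnumeration S c) where
  private
    module S = NumericalSemigroup S
    open IsGapEnumeration gap

  gap-∉ : ∀ i → c i ∉ₛ S
  gap-∉ i = Equivalence.from (enumerates (c i)) (i , ≡.refl)

  gap-injective : ∀ {i j} → c i ≡ c j → i ≡ j
  gap-injective {i} {j} ci≡cj with <ᶠ-cmp i j
  ... | tri< i<j _ _ = contradiction ci≡cj (<⇒≢ (increasing i<j))
  ... | tri≈ _ i≡j _ = i≡j
  ... | tri> _ _ j<i = contradiction (≡.sym ci≡cj) (<⇒≢ (increasing j<i))

  gap-reflects-< : ∀ {i j} → c i < c j → toℕ i < toℕ j
  gap-reflects-< {i} {j} ci<cj with <ᶠ-cmp i j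
  ... | tri< i<j _ _    = i<j
  ... | tri≈ _ ≡.refl _ = contradiction ≡.refl (<⇒≢ ci<cj)
  ... | tri> _ _ j<i    = contradiction ci<cj (<-asym (increasing j<i))

  elements-gaps : elements (gaps S) ↭ tabulate c
  elements-gaps = unique∧⇔⇒↭ (FiniteSet.elements-! (gaps S)) (tabulate⁺ gap-injective)
    (mk⇔ toTabulate fromTabulate ⇔-∘ FiniteSet.∈-elements (gaps S))
    where
    toTabulate : ∀ {x} → x ∉ₛ S → x ∈ˡ tabulate c
    toTabulate {x} x∉S with i , ≡.refl ← Equivalence.to (enumerates x) x∉S = ∈-tabulate⁺ i

    fromTabulate : ∀ {x} → x ∈ˡ tabulate c → x ∉ₛ S
    fromTabulate x∈ with i , ≡.refl ← ∈-tabulate⁻ x∈ = gap-∉ i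

  truncate-all : ∀ {x} → x ∈ₛ truncate S gap n ⇔ x ∈ₛ S
  truncate-all {x} = mk⇔ to λ x∈S j _ x≡cj → gap-∉ j (≡.subst (_∈ₛ S) x≡cj x∈S)
    where
    to : x ∈ₛ truncate S gap n → x ∈ₛ S
    to x∈ = decidable-stable (x S.∈?) λ x∉S →
      let i , ci≡x = Equivalence.to (enumerates x) x∉S in x∈ i (toℕ<n i) (≡.sym ci≡x)

  -- A gap below `c i` is some `c j` with `j` smaller than `i`, and the truncation has already lost
  -- all such gaps.
  truncate-< : ∀ {i x} → x ∈ₛ truncate S gap (toℕ i) → x < c i → x ∈ₛ S
  truncate-< {i} {x} x∈ x<ci = decidable-stable (x S.∈?) not-gap
    where
    not-gap : ¬ (x ∉ₛ S)
    not-gap x∉S with j , ≡.refl ← Equivalence.to (enumerates x) x∉S =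
      x∈ j (gap-reflects-< x<ci) ≡.refl

  truncate-antitone : ∀ {i j x} → i ≤ j → x ∈ₛ truncate S gap j → x ∈ₛ truncate S gap i
  truncate-antitone i≤j x∈ k k<i = x∈ k (<-≤-trans k<i i≤j)

  -- Among the indices below `suc (toℕ i)` only `i` itself is new, and there the hypothesis
  -- `x ≢ c i` applies.
  truncate-suc : ∀ {i x} → x ∈ₛ truncate S gap (toℕ i) → x ≢ c i → x ∈ₛ truncate S gap (suc (toℕ i))
  truncate-suc {i} x∈ x≢ci j (s≤s j≤i) with j Fin.≟ i
  ... | yes ≡.refl = x≢ci
  ... | no  j≢i    = x∈ j (≤∧≢⇒< j≤i (j≢i ∘ toℕ-injective))

  gap∈truncate : ∀ i → c i ∈ₛ truncate S gap (toℕ i)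
  gap∈truncate i j j<i ci≡cj = <⇒≢ (increasing j<i) (≡.sym ci≡cj)

  gap∉truncate : ∀ i → c i ∉ₛ truncate S gap (suc (toℕ i))
  gap∉truncate i ci∈ = ci∈ i ≤-refl ≡.refl

  -- Apéry sets at the two ends of the chain of truncations.

  module _ (m : ℕ) where

    Apéry-truncate-0 : elements (Apéry (truncate S gap 0) m) ↭ elements (I m)
    Apéry-truncate-0 = elements-cong (Apéry (truncate S gap 0) m) (I m) (mk⇔
      -- No `j` has `toℕ j < 0`, so every number lies in this truncation and the Apéry condition
      -- reduces to the failure of `m ≤ x`.
      (λ (_ , x-m∉) → ≰⇒> λ m≤x → x-m∉ (m≤x , λ _ ()))
      (λ x<m → (λ _ ()) , λ (m≤x , _) → <⇒≱ x<m m≤x))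

    Apéry-truncate-all : elements (Apéry (truncate S gap n) m) ↭ elements (Apéry S m)
    Apéry-truncate-all = elements-cong (Apéry (truncate S gap n) m) (Apéry S m) (mk⇔
      (λ (x∈ , x-m∉) → to x∈ , λ (m≤x , x-m∈S) → x-m∉ (m≤x , from x-m∈S))
      (λ (x∈S , x-m∉S) → from x∈S , λ (m≤x , x-m∈) → x-m∉S (m≤x , to x-m∈)))
      where
      to : ∀ {x} → x ∈ₛ truncate S gap n → x ∈ₛ S
      to = Equivalence.to truncate-all

      from : ∀ {x} → x ∈ₛ S → x ∈ₛ truncate S gap n
      from = Equivalence.from truncate-all

  -- The Apéry set when one gap is removed.

  module _ {m : ℕ} (m∈S : m ∈ₛ S) (m>0 : 0 < m) (i : Fin n) where
    private
      -- Two consecutive members of the chain, not its first two: `c i` belongs to `S₀` and is the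
      -- one element that `S₁` lacks.
      S₀ S₁ : NumericalSemigroup
      S₀ = truncate S gap (toℕ i)
      S₁ = truncate S gap (suc (toℕ i))

      S₁⊆S₀ : ∀ {x} → x ∈ₛ S₁ → x ∈ₛ S₀
      S₁⊆S₀ = truncate-antitone (n≤1+n _)

      x-m≡ci⇒x≡ci+m : ∀ {x} → m ≤ x → x ∸ m ≡ c i → x ≡ c i ℕ.+ m
      x-m≡ci⇒x≡ci+m m≤x x-m≡ci = ≡.trans (≡.sym (m∸n+n≡m m≤x)) (≡.cong (ℕ._+ m) x-m≡ci)

    -- If `c i ∸ m` were in `S₀`, then, being below `c i`, it would lie in `S`; adding `m` would put
    -- the gap `c i` into `S`.
    gap∈Apéry : FiniteSet.carrier (Apéry S₀ m) (c i)
    gap∈Apéry = gap∈truncate i , λ (m≤ci , ci-m∈S₀) → gap-∉ i $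
      ≡.subst (_∈ₛ S) (m∸n+n≡m m≤ci)
        (S.+-closed (truncate-< ci-m∈S₀ (∸-monoʳ-< m>0 m≤ci)) m∈S)

    -- The number `c i + m` exceeds every gap removed so far, and subtracting `m` gives `c i`, which
    -- has just been removed.
    gap+m∈Apéry : FiniteSet.carrier (Apéry S₁ m) (c i ℕ.+ m)
    gap+m∈Apéry =
      truncate-suc (λ j j<i ci+m≡cj →
        <⇒≢ (<-trans (increasing j<i) (m<m+n (c i) m>0)) (≡.sym ci+m≡cj))
        (λ ci+m≡ci → <⇒≢ (m<m+n (c i) m>0) (≡.sym ci+m≡ci)) ,
      λ (_ , ci∈S₁) → gap∉truncate i (≡.subst (_∈ₛ S₁) (m+n∸n≡m (c i) m) ci∈S₁)

    -- Since `S₀` and `S₁` differ only in `c i`, the two Apéry conditions can differ only at `c i`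
    -- and `c i + m`. Of these, `c i + m` fails the condition for `S₀` because `c i` lies in `S₀`,
    -- and `c i` fails the one for `S₁` because it is missing there.
    Apéry∖gap↭T : elements (Apéry S₀ m ∖｛ c i ｝) ↭ elements (T S gap m i)
    Apéry∖gap↭T = elements-cong (Apéry S₀ m ∖｛ c i ｝) (T S gap m i) (mk⇔ to from)
      where
      to : ∀ {x} → FiniteSet.carrier (Apéry S₀ m ∖｛ c i ｝) x → FiniteSet.carrier (T S gap m i) x
      to ((x∈S₀ , x-m∉S₀) , x≢ci) =
        (truncate-suc x∈S₀ x≢ci , λ (m≤x , x-m∈S₁) → x-m∉S₀ (m≤x , S₁⊆S₀ x-m∈S₁)) ,
        λ { ≡.refl → x-m∉S₀ ( m≤n+m m (c i)
                            , ≡.subst (_∈ₛ S₀) (≡.sym (m+n∸n≡m (c i) m)) (gap∈truncate i)) }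

      from : ∀ {x} → FiniteSet.carrier (T S gap m i) x → FiniteSet.carrier (Apéry S₀ m ∖｛ c i ｝) x
      from ((x∈S₁ , x-m∉S₁) , x≢ci+m) =
        (S₁⊆S₀ x∈S₁ , λ (m≤x , x-m∈S₀) →
          x-m∉S₁ (m≤x , truncate-suc x-m∈S₀ (x≢ci+m ∘ x-m≡ci⇒x≡ci+m m≤x))) ,
        λ { ≡.refl → gap∉truncate i x∈S₁ }

    -- With `Apéry-after` this gives two lists with a common tail, so one step of the chain only
    -- changes the head.
    Apéry-before : elements (Apéry S₀ m) ↭ c i ∷ elements (T S gap m i)
    Apéry-before = ↭-trans (elements-∖ (Apéry S₀ m) gap∈Apéry) (prep (c i) Apéry∖gap↭T)

    Apéry-after : elements (Apéry S₁ m) ↭ c i ℕ.+ m ∷ elements (T S gap m i)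
    Apéry-after = elements-∖ (Apéry S₁ m) gap+m∈Apéry

-- Symmetric functions of lists.

module SymmetricFunctionProperties {a ℓ} (R : CommutativeRing a ℓ) where
  open CommutativeRing R
    renaming (refl to ≈-refl; sym to ≈-sym; trans to ≈-trans)
  open SymmetricFunctions R
  open import Algebra.Properties.CommutativeMonoid.Sum +-commutativeMonoid
    using (sum)
  open import Algebra.Properties.Group +-group using (//-rightDividesˡ; //-rightDividesʳ)
  open import Algebra.Properties.CommutativeSemigroup +-commutativeSemigroup using (interchange)
  open SetoidPermutation setoid using (foldr-commMonoid)
  open ≈-Reasoning setoid

  Symmetric : ∀ {b} {B : Set b} → (List B → Carrier) → Set _
  Symmetric F = F Preserves _↭_ ⟶ _≈_

  product-symmetric : Symmetric (foldr _*_ 1#)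
  product-symmetric = foldr-commMonoid *-isCommutativeMonoid ∘ ↭⇒↭ₛ′ isEquivalence

  sumOver-symmetric : ∀ {b} {B : Set b} (g : B → Carrier) → Symmetric (λ xs → sumOver xs g)
  sumOver-symmetric g = foldr-commMonoid +-isCommutativeMonoid ∘ ↭⇒↭ₛ′ isEquivalence ∘ map⁺ g

  module _ {b} {B : Set b} where

    sumOver-cong : ∀ {g h : B → Carrier} xs → (∀ x → g x ≈ h x) → sumOver xs g ≈ sumOver xs h
    sumOver-cong []       g≈h = ≈-refl
    sumOver-cong (x ∷ xs) g≈h = +-cong (g≈h x) (sumOver-cong xs g≈h)

    sumOver-++ : ∀ {g : B → Carrier} xs ys → sumOver (xs ++ ys) g ≈ sumOver xs g + sumOver ys g
    sumOver-++ []       ys = ≈-sym (+-identityˡ _)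
    sumOver-++ (x ∷ xs) ys = ≈-trans (+-congˡ (sumOver-++ xs ys)) (≈-sym (+-assoc _ _ _))

    sumOver-map : ∀ {d} {D : Set d} {g : B → Carrier} (h : D → B) xs →
                  sumOver (map h xs) g ≈ sumOver xs (g ∘ h)
    sumOver-map h []       = ≈-refl
    sumOver-map h (x ∷ xs) = +-congˡ (sumOver-map h xs)

    sumOver-+ : ∀ {g h : B → Carrier} xs → sumOver xs (λ x → g x + h x) ≈ sumOver xs g + sumOver xs h
    sumOver-+ []       = ≈-sym (+-identityˡ _)
    sumOver-+ (x ∷ xs) = ≈-trans (+-congˡ (sumOver-+ xs)) (interchange _ _ _ _)

    sumOver-*ˡ : ∀ {g : B → Carrier} y xs → sumOver xs (λ x → y * g x) ≈ y * sumOver xs g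
    sumOver-*ˡ y []       = ≈-sym (zeroʳ y)
    sumOver-*ˡ y (x ∷ xs) = ≈-trans (+-congˡ (sumOver-*ˡ y xs)) (≈-sym (distribˡ _ _ _))

  module _ {b} {B : Set b} where

    sumOver-choose-∷ : ∀ {g : List B → Carrier} k x xs →
      sumOver (choose (suc k) (x ∷ xs)) g ≈ sumOver (choose k xs) (g ∘ (x ∷_)) + sumOver (choose (suc k) xs) g
    sumOver-choose-∷ k x xs =
      ≈-trans (sumOver-++ (map (x ∷_) (choose k xs)) _) (+-congʳ (sumOver-map (x ∷_) (choose k xs)))

    -- Permuting a list reorders its chosen sublists and also the entries inside each, so `g` itself
    -- must be symmetric. The induction is on the permutation with `g` varying, because a fixed head
    -- replaces `g` by `g ∘ (x ∷_)`.
    sumOver-choose-symmetric : ∀ {g : List B → Carrier} → Symmetric g →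
                               ∀ k → Symmetric (λ xs → sumOver (choose k xs) g)
    sumOver-choose-symmetric g-sym zero    _    = ≈-refl
    sumOver-choose-symmetric g-sym (suc k) refl = ≈-refl
    sumOver-choose-symmetric {g} g-sym (suc k) (prep {xs} {ys} x xs↭ys) = begin
      sumOver (choose (suc k) (x ∷ xs)) g
        ≈⟨ sumOver-choose-∷ k x xs ⟩
      sumOver (choose k xs) (g ∘ (x ∷_)) + sumOver (choose (suc k) xs) g
        ≈⟨ +-cong (sumOver-choose-symmetric (g-sym ∘ prep x) k xs↭ys)
                  (sumOver-choose-symmetric g-sym (suc k) xs↭ys) ⟩
      sumOver (choose k ys) (g ∘ (x ∷_)) + sumOver (choose (suc k) ys) g
        ≈⟨ sumOver-choose-∷ k x ys ⟨
      sumOver (choose (suc k) (x ∷ ys)) g ∎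
    sumOver-choose-symmetric {g} g-sym (suc k) (swap {xs} {ys} x y xs↭ys) = swapped k
      where
      choose-∷∷ : ∀ k x y xs → sumOver (choose (suc k) (x ∷ y ∷ xs)) g ≈
        sumOver (choose k (y ∷ xs)) (g ∘ (x ∷_)) +
        (sumOver (choose k xs) (g ∘ (y ∷_)) + sumOver (choose (suc k) xs) g)
      choose-∷∷ k x y xs = ≈-trans (sumOver-choose-∷ k x (y ∷ xs)) (+-congˡ (sumOver-choose-∷ k y xs))

      swapped : ∀ k → sumOver (choose (suc k) (x ∷ y ∷ xs)) g ≈ sumOver (choose (suc k) (y ∷ x ∷ ys)) g
      -- One position cannot hold both `x` and `y`. The sum over `choose 0` has the empty list as
      -- its only entry, hence the terms `g (x ∷ []) + 0#`.
      swapped zero = begin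
        sumOver (choose 1 (x ∷ y ∷ xs)) g
          ≈⟨ choose-∷∷ 0 x y xs ⟩
        (g (x ∷ []) + 0#) + ((g (y ∷ []) + 0#) + sumOver (choose 1 xs) g)
          ≈⟨ +-assoc _ _ _ ⟨
        ((g (x ∷ []) + 0#) + (g (y ∷ []) + 0#)) + sumOver (choose 1 xs) g
          ≈⟨ +-cong (+-comm _ _) (sumOver-choose-symmetric g-sym 1 xs↭ys) ⟩
        ((g (y ∷ []) + 0#) + (g (x ∷ []) + 0#)) + sumOver (choose 1 ys) g
          ≈⟨ +-assoc _ _ _ ⟩
        (g (y ∷ []) + 0#) + ((g (x ∷ []) + 0#) + sumOver (choose 1 ys) g)
          ≈⟨ choose-∷∷ 0 y x ys ⟨
        sumOver (choose 1 (y ∷ x ∷ ys)) g ∎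
      -- Four blocks arise: sublists with both of `x` and `y`, only `x`, only `y`, or neither.
      -- `interchange` exchanges the two middle blocks, and symmetry of `g` under `swap` handles the
      -- first.
      swapped (suc k) = begin
        sumOver (choose (suc (suc k)) (x ∷ y ∷ xs)) g
          ≈⟨ choose-∷∷ (suc k) x y xs ⟩
        sumOver (choose (suc k) (y ∷ xs)) (g ∘ (x ∷_)) +
        (sumOver (choose (suc k) xs) (g ∘ (y ∷_)) + sumOver (choose (suc (suc k)) xs) g)
          ≈⟨ +-congʳ (sumOver-choose-∷ k y xs) ⟩
        (sumOver (choose k xs) (g ∘ (x ∷_) ∘ (y ∷_)) + sumOver (choose (suc k) xs) (g ∘ (x ∷_))) +
        (sumOver (choose (suc k) xs) (g ∘ (y ∷_)) + sumOver (choose (suc (suc k)) xs) g)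
          ≈⟨ interchange _ _ _ _ ⟩
        (sumOver (choose k xs) (g ∘ (x ∷_) ∘ (y ∷_)) + sumOver (choose (suc k) xs) (g ∘ (y ∷_))) +
        (sumOver (choose (suc k) xs) (g ∘ (x ∷_)) + sumOver (choose (suc (suc k)) xs) g)
          ≈⟨ +-cong
               (+-cong
                 (≈-trans
                   (sumOver-cong (choose k xs) (λ zs → g-sym (swap x y refl)))
                   (sumOver-choose-symmetric (g-sym ∘ prep y ∘ prep x) k xs↭ys))
                 (sumOver-choose-symmetric (g-sym ∘ prep y) (suc k) xs↭ys))
               (+-cong
                 (sumOver-choose-symmetric (g-sym ∘ prep x) (suc k) xs↭ys)
                 (sumOver-choose-symmetric g-sym (suc (suc k)) xs↭ys)) ⟩
        (sumOver (choose k ys) (g ∘ (y ∷_) ∘ (x ∷_)) + sumOver (choose (suc k) ys) (g ∘ (y ∷_))) +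
        (sumOver (choose (suc k) ys) (g ∘ (x ∷_)) + sumOver (choose (suc (suc k)) ys) g)
          ≈⟨ +-congʳ (sumOver-choose-∷ k x ys) ⟨
        sumOver (choose (suc k) (x ∷ ys)) (g ∘ (y ∷_)) +
        (sumOver (choose (suc k) ys) (g ∘ (x ∷_)) + sumOver (choose (suc (suc k)) ys) g)
          ≈⟨ choose-∷∷ (suc k) y x ys ⟨
        sumOver (choose (suc (suc k)) (y ∷ x ∷ ys)) g ∎
    sumOver-choose-symmetric g-sym (suc k) (trans xs↭ys ys↭zs) =
      ≈-trans (sumOver-choose-symmetric g-sym (suc k) xs↭ys)
              (sumOver-choose-symmetric g-sym (suc k) ys↭zs)

  e-symmetric : ∀ k → Symmetric (e k)
  e-symmetric = sumOver-choose-symmetric product-symmetric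

  -- Monomials are split by whether they contain `x`; this exhibits `e (suc k)` as affine in the
  -- head.
  e-∷ : ∀ k x xs → e (suc k) (x ∷ xs) ≈ x * e k xs + e (suc k) xs
  e-∷ k x xs = ≈-trans (sumOver-choose-∷ k x xs) (+-congʳ (sumOver-*ˡ x (choose k xs)))

  sum-tabulate : ∀ {b} {B : Set b} {n} (c : Fin n → B) (g : B → Carrier) →
                 sumOver (tabulate c) g ≈ ∑[ i < n ] g (c i)
  sum-tabulate {n = zero}  c g = ≈-refl
  sum-tabulate {n = suc n} c g = +-congˡ (sum-tabulate (c ∘ Fin.suc) g)

  -- The steps are stated as additions, so the induction needs no subtraction: it absorbs the first
  -- term into `G 0` and shifts `G`.
  telescope : ∀ {n} (G : ℕ → Carrier) (d : Fin n → Carrier) →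
              (∀ i → d i + G (toℕ i) ≈ G (suc (toℕ i))) → (∑[ i < n ] d i) + G 0 ≈ G n
  telescope {zero}  G d step = +-identityˡ (G 0)
  telescope {suc n} G d step = begin
    (d Fin.zero + sum (d ∘ Fin.suc)) + G 0  ≈⟨ +-congʳ (+-comm _ _) ⟩
    (sum (d ∘ Fin.suc) + d Fin.zero) + G 0  ≈⟨ +-assoc _ _ _ ⟩
    sum (d ∘ Fin.suc) + (d Fin.zero + G 0)  ≈⟨ +-congˡ (step Fin.zero) ⟩
    sum (d ∘ Fin.suc) + G 1                 ≈⟨ telescope (G ∘ suc) (d ∘ Fin.suc) (step ∘ Fin.suc) ⟩
    G (suc n)                               ∎

  -- Sums of elementary symmetric functions over subsets of fixed size.

  module _ (f : ℕ → Carrier) where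

    -- With r the length of `xs` and k ≤ p ≤ r, this is the binomial multiple C(r-k, p-k) of
    -- `e k (map f xs)`, as each choice of k positions extends to that many choices of p.
    E : ℕ → ℕ → List ℕ → Carrier
    E p k xs = ∑[ A ∈ choose p xs ] e k (map f A)

    E-symmetric : ∀ p k → Symmetric (E p k)
    E-symmetric p k = sumOver-choose-symmetric (e-symmetric k ∘ map⁺ f) p

    -- Choices containing `x` are expanded by `e-∷`. The coefficient of `f x` is `E p k xs`, which
    -- is why both indices drop by one in the sum over subsets of `T`.
    E-∷ : ∀ p k x xs →
      E (suc p) (suc k) (x ∷ xs) ≈ f x * E p k xs + (E p (suc k) xs + E (suc p) (suc k) xs)
    E-∷ p k x xs = begin
      E (suc p) (suc k) (x ∷ xs)
        ≈⟨ sumOver-choose-∷ p x xs ⟩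
      (∑[ A ∈ choose p xs ] e (suc k) (f x ∷ map f A)) + E (suc p) (suc k) xs
        ≈⟨ +-congʳ (sumOver-cong (choose p xs) (λ A → e-∷ k (f x) (map f A))) ⟩
      (∑[ A ∈ choose p xs ] (f x * e k (map f A) + e (suc k) (map f A))) + E (suc p) (suc k) xs
        ≈⟨ +-congʳ (sumOver-+ (choose p xs)) ⟩
      ((∑[ A ∈ choose p xs ] (f x * e k (map f A))) + E p (suc k) xs) + E (suc p) (suc k) xs
        ≈⟨ +-congʳ (+-congʳ (sumOver-*ˡ (f x) (choose p xs))) ⟩
      (f x * E p k xs + E p (suc k) xs) + E (suc p) (suc k) xs
        ≈⟨ +-assoc _ _ _ ⟩
      f x * E p k xs + (E p (suc k) xs + E (suc p) (suc k) xs) ∎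

    -- Telescoping along the chain of truncations.

    module _ (S : NumericalSemigroup) {m : ℕ} (m∈S : m ∈ₛ S) (m>0 : 0 < m)
             {n : ℕ} {c : Fin n → ℕ} (gap : IsGapEnumeration S c) where

      -- Keeping `F`, `G` and `H` abstract lets one telescoping argument serve all three identities;
      -- symmetry makes `F` depend only on the set that a list enumerates.
      gap-sum : {F G H : List ℕ → Carrier} → Symmetric F →
        (∀ x xs → F (x ∷ xs) ≈ f x * G xs + H xs) →
        ∑[ i < n ] ((f (c i ℕ.+ m) - f (c i)) * G (elements (T S gap m i)))
          ≈ F (elements (Apéry S m)) - F (elements (I m))
      gap-sum {F} {G} {H} F-sym F-∷ = begin
        total                                          ≈⟨ //-rightDividesʳ (F₍ 0 ₎) total ⟨
        (total + F₍ 0 ₎) - F₍ 0 ₎                      ≈⟨ +-congʳ (telescope F₍_₎ d step) ⟩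
        F₍ n ₎ - F₍ 0 ₎                                ≈⟨ +-cong (F-sym (Apéry-truncate-all S gap m))
                                                            (-‿cong (F-sym (Apéry-truncate-0 S gap m))) ⟩
        F (elements (Apéry S m)) - F (elements (I m))  ∎
        where
        F₍_₎ : ℕ → Carrier
        F₍ i ₎ = F (elements (Apéry (truncate S gap i) m))

        d : Fin n → Carrier
        d i = (f (c i ℕ.+ m) - f (c i)) * G (elements (T S gap m i))

        total : Carrier
        total = ∑[ i < n ] d i

        step : ∀ i → d i + F₍ toℕ i ₎ ≈ F₍ suc (toℕ i) ₎
        step i = begin
          d i + F₍ toℕ i ₎
            ≈⟨ +-congˡ (F-sym (Apéry-before S gap m∈S m>0 i)) ⟩
          d i + F (c i ∷ Tᵢ)
            ≈⟨ +-congˡ (F-∷ (c i) Tᵢ) ⟩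
          d i + (f (c i) * G Tᵢ + H Tᵢ)
            ≈⟨ +-assoc _ _ _ ⟨
          (d i + f (c i) * G Tᵢ) + H Tᵢ
            ≈⟨ +-congʳ (distribʳ (G Tᵢ) _ _) ⟨
          ((f (c i ℕ.+ m) - f (c i)) + f (c i)) * G Tᵢ + H Tᵢ
            ≈⟨ +-congʳ (*-congʳ (//-rightDividesˡ (f (c i)) (f (c i ℕ.+ m)))) ⟩
          f (c i ℕ.+ m) * G Tᵢ + H Tᵢ
            ≈⟨ F-∷ (c i ℕ.+ m) Tᵢ ⟨
          F (c i ℕ.+ m ∷ Tᵢ)
            ≈⟨ F-sym (Apéry-after S gap m∈S m>0 i) ⟨
          F₍ suc (toℕ i) ₎ ∎
          where
          Tᵢ : List ℕ
          Tᵢ = elements (T S gap m i)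

-- The three identities as instances of the telescoped sum.

mainTheorem3 : ∀ {a ℓ} (S : NumericalSemigroup) → ¬ (∀ x → x ∈ₛ S) →
  (m : ℕ) → m ∈ₛ S → m ≢ 0 →
  (n : ℕ) (c : Fin n → ℕ) (gap : IsGapEnumeration S c) →
  (R : CommutativeRing a ℓ) →
  let open CommutativeRing R
      open SymmetricFunctions R
  in (f : ℕ → Carrier) →
  (∀ p → 0 < p → p ≤ m → ∀ k → 1 ≤ k → k ≤ p →
    (∑[ i < n ] ((f (c i ℕ.+ m) - f (c i)) * (∑[ J ∈ subsets (p ∸ 1) (T S gap m i) ] e (k ∸ 1) (map f J))))
      ≈ (∑[ A ∈ subsets p (Apéry S m) ] e k (map f A)) - (∑[ A ∈ subsets p (I m) ] e k (map f A)))
  × (∀ k → 1 ≤ k → k ≤ m →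
    (∑[ i < n ] ((f (c i ℕ.+ m) - f (c i)) * e (k ∸ 1) (map f (elements (T S gap m i)))))
      ≈ e k (map f (elements (Apéry S m))) - e k (map f (elements (I m))))
  × (∑[ x ∈ elements (gaps S) ] (f (x ℕ.+ m) - f x))
      ≈ (∑[ x ∈ elements (Apéry S m) ] f x) - (∑[ x ∈ elements (I m) ] f x)
mainTheorem3 S _ m m∈S m≢0 n c gap R f = subset-identity , full-identity , linear-identity
  where
  open CommutativeRing R
    renaming (sym to ≈-sym; trans to ≈-trans)
  open SymmetricFunctions R
  open SymmetricFunctionProperties R
  open import Algebra.Properties.CommutativeMonoid.Sum +-commutativeMonoid using (sum-cong-≋)

  m>0 : 0 < m
  m>0 = n≢0⇒n>0 m≢0

  subset-identity : ∀ p → 0 < p → p ≤ m → ∀ k → 1 ≤ k → k ≤ p →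
    (∑[ i < n ] ((f (c i ℕ.+ m) - f (c i)) * (∑[ J ∈ subsets (p ∸ 1) (T S gap m i) ] e (k ∸ 1) (map f J))))
      ≈ (∑[ A ∈ subsets p (Apéry S m) ] e k (map f A)) - (∑[ A ∈ subsets p (I m) ] e k (map f A))
  -- The bounds `0 < p` and `1 ≤ k` make both numbers successors, so `p ∸ 1` and `k ∸ 1` compute to
  -- the indices of the coefficient in `E-∷`.
  subset-identity (suc p) _ _ (suc k) _ _ =
    gap-sum f S m∈S m>0 gap (E-symmetric f (suc p) (suc k)) (E-∷ f p k)

  full-identity : ∀ k → 1 ≤ k → k ≤ m →
    (∑[ i < n ] ((f (c i ℕ.+ m) - f (c i)) * e (k ∸ 1) (map f (elements (T S gap m i)))))
      ≈ e k (map f (elements (Apéry S m))) - e k (map f (elements (I m)))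
  -- Taking `F` to be `e (suc k) ∘ map f` on the whole list avoids counting the elements of the
  -- three sets, which specializing the subset sums to size `m` would require.
  full-identity (suc k) _ _ =
    gap-sum f S m∈S m>0 gap (e-symmetric (suc k) ∘ map⁺ f) (λ x xs → e-∷ k (f x) (map f xs))

  linear-identity : (∑[ x ∈ elements (gaps S) ] (f (x ℕ.+ m) - f x))
    ≈ (∑[ x ∈ elements (Apéry S m) ] f x) - (∑[ x ∈ elements (I m) ] f x)
  linear-identity =
    ≈-trans (sumOver-symmetric _ (elements-gaps S gap)) $
    ≈-trans (sum-tabulate c _) $
    -- The factor `1#` is the constant value of `G`: a plain sum of values is affine in each `f x`
    -- with coefficient one.
    ≈-trans (sum-cong-≋ {n} (λ i → ≈-sym (*-identityʳ _))) $
    gap-sum f S m∈S m>0 gap (sumOver-symmetric f) (λ x xs → +-congʳ (≈-sym (*-identityʳ (f x))))
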